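{- For every integer $n\ge 3$, \[\sum_{i=0}^{\lfloor n/3\rfloor-1}\prod_{j=1}^i\frac{ -\binom{n-3j}{3}}{\binom{n}{3}-\binom{n-3j}{3}} =\Bigl\lfloor\frac{n}{3}\Bigr\rfloor\cdot\frac{\displaystyle\prod_{\substack{n+1\le j\le \lfloor3n/2\rfloor-2\\3\nmid j}}c_j}{\displaystyle\prod_{\substack{3\le j\le n-3\\3\mid j}}c_j},\] where for each integer $j$, \[c_j=j^2 + (3-3n)j + 3n^2-6n+2\quad\Bigl(=\tfrac{6}{j}\bigl(\tbinom{n}{3}-\tbinom{n-j}{3}\bigr)\text{ for } j\neq 0\Bigr).\]
   Context: Empty products are equal to $1$. Here $\binom{x}{3}=x(x-1)(x-2)/6$ for any integer $x$. (The left-hand side equals the probability that a uniformly random vertex ordering of the line graph of the complete $3$-uniform hypergraph on $n$ vertices is successive, i.e. every initial segment induces a connected subgraph; this interpretation is not needed for the identity.) -}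

module Defs where

open import Data.Nat as ℕ using (ℕ; zero; suc; _∸_)
open import Data.Nat.Divisibility using (_∣?_)
open import Data.Integer as ℤ using (ℤ; +_)
open import Data.Rational as ℚ using (ℚ; 0ℚ; 1ℚ; _≟_)
open import Data.List using (List; []; _∷_; applyUpTo; filter; map; foldr)
open import Relation.Nullary using (yes; no; ¬?)

binom3 : ℤ → ℚ
binom3 x = (x ℤ.* (x ℤ.- + 1) ℤ.* (x ℤ.- + 2)) ℚ./ 6

-- total division on ℚ (p / 0 := 0); only ever applied to nonzero denominators
div : ℚ → ℚ → ℚ
div p q with q ≟ 0ℚ
... | yes _ = 0ℚ
... | no q≢0 = p ℚ.÷ q
  where instance _ = ℚ.≢-nonZero q≢0

range : ℕ → ℕ → List ℕ
range a b = applyUpTo (λ k → a ℕ.+ k) (suc b ∸ a)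

sumQ : List ℕ → (ℕ → ℚ) → ℚ
sumQ js f = foldr (λ j acc → f j ℚ.+ acc) 0ℚ js

prodQ : List ℕ → (ℕ → ℚ) → ℚ
prodQ js f = foldr (λ j acc → f j ℚ.* acc) 1ℚ js

c : ℕ → ℤ → ℚ
c n j = (j ℤ.* j ℤ.+ (+ 3 ℤ.- + 3 ℤ.* + n) ℤ.* j
          ℤ.+ + 3 ℤ.* + n ℤ.* + n ℤ.- + 6 ℤ.* + n ℤ.+ + 2) ℚ./ 1

lhs : ℕ → ℚ
lhs n = sumQ (range 0 (n ℕ./ 3 ∸ 1)) λ i →
          prodQ (range 1 i) λ j →
            div (ℚ.- binom3 (+ n ℤ.- + (3 ℕ.* j)))
                (binom3 (+ n) ℚ.- binom3 (+ n ℤ.- + (3 ℕ.* j)))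

rhs : ℕ → ℚ
rhs n = (+ (n ℕ./ 3) ℚ./ 1) ℚ.*
        div (prodQ (filter (λ j → ¬? (3 ∣? j)) (range (suc n) ((3 ℕ.* n) ℕ./ 2 ∸ 2))) (λ j → c n (+ j)))
            (prodQ (filter (λ j → 3 ∣? j) (range 3 (n ∸ 3))) (λ j → c n (+ j)))

{-# OPTIONS --safe #-}

-- Put f(x) = x(x-1)(x-2), so that 6 (binom(n,3) - binom(n-j,3)) = f(n) - f(n-j) = j c_j.
-- The left-hand side is g(1) for the monic polynomial g of degree n-3 such that P = (u³-1) g
-- solves (u³-1) P''' = f(n) P with exponents ≡ n mod 3.  Since P'(1) = 3 g(1), the sum can be
-- exchanged (summation by parts) for the coefficient sum P'(1), which is a balanced terminating
-- ₃F₂(1) and is evaluated by the Pfaff–Saalschütz theorem.  This gives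
--   ⌊n/3⌋ ∏_{1≤l<⌊n/3⌋} c_{n+3l-t} / c_{3l},   t = 2 if 3 ∣ n and t = 0 otherwise.
-- Finally c_j = c_{3n-3-j} folds the indices n+3l-t lying above the centre of symmetry onto the
-- other admissible residue class below it, which turns the single class over the full range into
-- both classes j ≢ 0 mod 3 over the half range.
module Submission where

open import Defs
open import Data.Nat as ℕ using (ℕ; zero; suc; _∸_; _≤_; z≤n; s≤s)
open import Data.Nat.Coprimality using (1-coprimeTo) renaming (sym to coprime-sym)
open import Data.Nat.Divisibility using (_∣_; _∣?_; n∣m*n; ∣m+n∣m⇒∣n; >⇒∤)
open import Data.Nat.DivMod using (m≡m%n+[m/n]*n; m%n<n; +-distrib-/-∣ʳ; m<n⇒m/n≡0; m*n/n≡m)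
import Data.Nat.Properties as ℕ
import Data.Nat.Tactic.RingSolver as ℕ-Solver
open import Data.Integer as ℤ hiding (suc; _≤_)
open import Data.Integer.Properties
open import Data.Integer.Tactic.RingSolver using (solve-∀)
open import Data.List using ([]; _∷_; _∷ʳ_; _++_; applyUpTo; filter)
open import Data.List.Properties using (applyUpTo-∷ʳ; filter-++; filter-accept; filter-reject; ++-identityʳ)
open import Data.Product using (∃-syntax; _,_)
open import Data.Rational as ℚ using (ℚ; mkℚ; 0ℚ)
import Data.Rational.Properties as ℚ
open import Data.Rational.Solver using (module +-*-Solver)
import Data.Rational.Unnormalised as ℚᵘ
import Data.Rational.Unnormalised.Properties as ℚᵘ
open import Data.Sum using (_⊎_; inj₁; inj₂; [_,_]′)
open import Level using (0ℓ)
open import Relation.Binary.PropositionalEquality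
open import Relation.Nullary using (yes; no; ¬_; ¬?; contradiction)
open import Relation.Unary using (Pred; Decidable)

-- Finite products, and sums over a common denominator

-- Factors are indexed from 1: prod a k = a 1 ⋯ a k, and numer a d k is the numerator of
-- Σ_{0≤i≤k} ∏_{1≤l≤i} a l / d l over the common denominator prod d k.
prod : (ℕ → ℤ) → ℕ → ℤ
prod a zero    = + 1
prod a (suc k) = prod a k * a (suc k)

numer : (ℕ → ℤ) → (ℕ → ℤ) → ℕ → ℤ
numer a d zero    = + 1
numer a d (suc k) = numer a d k * d (suc k) + prod a (suc k)

prod-cong : ∀ {a b} → (∀ l → a l ≡ b l) → ∀ k → prod a k ≡ prod b k
prod-cong a≗b zero    = refl
prod-cong a≗b (suc k) = cong₂ _*_ (prod-cong a≗b k) (a≗b (suc k))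

numer-cong : ∀ {a b d e} → (∀ l → a l ≡ b l) → (∀ l → d l ≡ e l) →
             ∀ k → numer a d k ≡ numer b e k
numer-cong a≗b d≗e zero    = refl
numer-cong a≗b d≗e (suc k) =
  cong₂ _+_ (cong₂ _*_ (numer-cong a≗b d≗e k) (d≗e (suc k))) (prod-cong a≗b (suc k))

prod-* : ∀ a b k → prod (λ l → a l * b l) k ≡ prod a k * prod b k
prod-* a b zero    = refl
prod-* a b (suc k) =
  trans (cong (_* (a (suc k) * b (suc k))) (prod-* a b k)) (swap (prod a k) (prod b k) (a (suc k)) (b (suc k)))
  where
  swap : ∀ x y u v → x * y * (u * v) ≡ x * u * (y * v)
  swap = solve-∀

prod-head : ∀ a k → prod a (suc k) ≡ a 1 * prod (λ l → a (suc l)) k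
prod-head a zero    = *-comm (+ 1) (a 1)
prod-head a (suc k) = trans (cong (_* a (2 ℕ.+ k)) (prod-head a k)) (*-assoc (a 1) _ _)

-- The Pfaff-Saalschütz summation

-- The Pfaff–Saalschütz sum with all parameters scaled by 3.  The lower parameters are 1 - r/3 for the
-- two roots r of q, and the upper ones are -K/3, A/3 + 1 and B/3 + 1, where B = s + K - A - 3 is
-- forced by the balancing condition.
module Saalschütz (A s D : ℤ) where

  q : ℤ → ℤ
  q j = j * j + s * j + D

  den : ℕ → ℤ
  den l = + 3 * + l * q (+ 3 * + l)

  term : ℤ → ℕ → ℤ
  term K l = (+ 3 * + l - + 3 - K) * (A + + 3 * + l) * (s + K - A - + 3 + + 3 * + l)

  -- A common factor of the (L+1)-st terms for K and for K + 3, up to sign; it is also the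
  -- Wilf–Zeilberger certificate, up to the constant factor in telescope.
  boundary : ℤ → ℕ → ℤ
  boundary K zero    = A + + 3
  boundary K (suc L) =
    boundary K L * ((+ 3 * + L - K) * (A + + 3 * + L + + 6) * (s + K - A - + 3 + + 3 * + L + + 6))

  -- Raising `K` by 3 moves the first factor of `term` back by one index and the third forward by
  -- one. The products for `K + 3` and for `K` therefore differ only in factors at the ends.
  prod-term⁺ : ∀ K L → prod (term (K + + 3)) (suc L) ≡
               - ((K + + 3) * (s + K - A - + 3 + + 3 * + L + + 6) * boundary K L)
  prod-term⁺ K zero = ring K A s
    where
    ring : ∀ K A s → + 1 * ((+ 3 - + 3 - (K + + 3)) * (A + + 3) * (s + (K + + 3) - A - + 3 + + 3))
           ≡ - ((K + + 3) * (s + K - A - + 3 + + 0 + + 6) * (A + + 3))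
    ring = solve-∀
  prod-term⁺ K (suc L) =
    trans (cong (_* term (K + + 3) (2 ℕ.+ L)) (prod-term⁺ K L)) (ring (+ L) K A s (boundary K L))
    where
    ring : ∀ x K A s v →
      - ((K + + 3) * (s + K - A - + 3 + + 3 * x + + 6) * v)
        * ((+ 3 * (+ 2 + x) - + 3 - (K + + 3)) * (A + + 3 * (+ 2 + x)) * (s + (K + + 3) - A - + 3 + + 3 * (+ 2 + x)))
      ≡ - ((K + + 3) * (s + K - A - + 3 + + 3 * (+ 1 + x) + + 6)
           * (v * ((+ 3 * x - K) * (A + + 3 * x + + 6) * (s + K - A - + 3 + + 3 * x + + 6))))
    ring = solve-∀

  prod-term : ∀ K L → prod (term K) (suc L) ≡ (+ 3 * + L - K) * (s + K - A - + 3 + + 3) * boundary K L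
  prod-term K zero = ring K A s
    where
    ring : ∀ K A s → + 1 * ((+ 3 - + 3 - K) * (A + + 3) * (s + K - A - + 3 + + 3))
           ≡ (+ 0 - K) * (s + K - A - + 3 + + 3) * (A + + 3)
    ring = solve-∀
  prod-term K (suc L) =
    trans (cong (_* term K (2 ℕ.+ L)) (prod-term K L)) (ring (+ L) K A s (boundary K L))
    where
    ring : ∀ x K A s v →
      (+ 3 * x - K) * (s + K - A - + 3 + + 3) * v
        * ((+ 3 * (+ 2 + x) - + 3 - K) * (A + + 3 * (+ 2 + x)) * (s + K - A - + 3 + + 3 * (+ 2 + x)))
      ≡ (+ 3 * (+ 1 + x) - K) * (s + K - A - + 3 + + 3)
           * (v * ((+ 3 * x - K) * (A + + 3 * x + + 6) * (s + K - A - + 3 + + 3 * x + + 6)))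
    ring = solve-∀

  -- The Wilf-Zeilberger recurrence in `K`, for partial sums over the common denominator: the
  -- weighted difference of the two summands is a difference of consecutive certificates.
  telescope : ∀ K L →
    q (K + + 3) * numer (term (K + + 3)) den L - q (K - A) * numer (term K) den L
      ≡ (s + K - A - + 3 + K + + 6) * boundary K L
  telescope K zero = ring K A s D
    where
    ring : ∀ K A s D →
      ((K + + 3) * (K + + 3) + s * (K + + 3) + D) * + 1 - ((K - A) * (K - A) + s * (K - A) + D) * + 1
      ≡ (s + K - A - + 3 + K + + 6) * (A + + 3)
    ring = solve-∀
  telescope K (suc L) = begin
    Q * (N⁺ * d + P⁺) - Q′ * (N * d + P)
      ≡⟨ split Q Q′ N⁺ N P⁺ P d ⟩
    (Q * N⁺ - Q′ * N) * d + (Q * P⁺ - Q′ * P)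
      ≡⟨ cong₂ (λ x y → x * d + y) (telescope K L)
           (cong₂ (λ x y → Q * x - Q′ * y) (prod-term⁺ K L) (prod-term K L)) ⟩
    _ ≡⟨ ring (+ L) K A s D (boundary K L) ⟩
    (s + K - A - + 3 + K + + 6) * boundary K (suc L) ∎
    where
    open ≡-Reasoning
    Q = q (K + + 3)
    Q′ = q (K - A)
    N⁺ = numer (term (K + + 3)) den L
    N = numer (term K) den L
    P⁺ = prod (term (K + + 3)) (suc L)
    P = prod (term K) (suc L)
    d = den (suc L)
    split : ∀ Q Q′ N⁺ N P⁺ P d →
      Q * (N⁺ * d + P⁺) - Q′ * (N * d + P) ≡ (Q * N⁺ - Q′ * N) * d + (Q * P⁺ - Q′ * P)
    split = solve-∀
    ring : ∀ x K A s D v → let B = s + K - A - + 3 ; y = + 3 * (+ 1 + x) in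
      (B + K + + 6) * v * (y * (y * y + s * y + D))
      + (((K + + 3) * (K + + 3) + s * (K + + 3) + D) * - ((K + + 3) * (B + + 3 * x + + 6) * v)
         - ((K - A) * (K - A) + s * (K - A) + D) * ((+ 3 * x - K) * (B + + 3) * v))
      ≡ (B + K + + 6) * (v * ((+ 3 * x - K) * (A + + 3 * x + + 6) * (B + + 3 * x + + 6)))
    ring = solve-∀

  -- At `K = 3k` the factor `3l - 3 - K` is zero for `l = k + 1`: the series stops and
  -- `boundary K (suc k)` vanishes. `telescope` becomes a first-order recurrence in `k`, from which
  -- `q (3(k + 1))` cancels.
  sum-evaluation : (∀ l → q (+ 3 * + suc l) ≢ + 0) →
    ∀ k → numer (term (+ 3 * + k)) den k ≡ prod (λ l → + 3 * + l * q (+ 3 * + l - + 3 - A)) k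
  sum-evaluation q≢0 zero    = refl
  sum-evaluation q≢0 (suc k) = *-cancelˡ-≡ Q _ _ {{≢-nonZero (q≢0 k)}} (begin
    Q * N⁺                                ≡⟨ isolate (Q * N⁺) (Q′ * N) ⟩
    (Q * N⁺ - Q′ * N) + Q′ * N
      ≡⟨ cong (λ K⁺ → (q K⁺ * numer (term K⁺) den (suc k) - Q′ * N) + Q′ * N) (K-suc (+ k)) ⟩
    (q (K + + 3) * numer (term (K + + 3)) den (suc k) - Q′ * N) + Q′ * N
      ≡⟨ cong (_+ Q′ * N) (telescope K (suc k)) ⟩
    γ * boundary K (suc k) + Q′ * (numer (term K) den k * den (suc k) + prod (term K) (suc k))
      ≡⟨ cong (λ p → γ * boundary K (suc k) + Q′ * (numer (term K) den k * den (suc k) + p))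
           (prod-term K k) ⟩
    γ * boundary K (suc k) + Q′ * (numer (term K) den k * den (suc k) + Z)
      ≡⟨ cong (λ y → γ * boundary K (suc k) + Q′ * (y * den (suc k) + Z)) (sum-evaluation q≢0 k) ⟩
    γ * boundary K (suc k) + Q′ * (Y * den (suc k) + Z)
      ≡⟨ vanish γ (boundary K k) K _ _ Q′ Y (den (suc k)) _ ⟩
    Q′ * (Y * den (suc k))                ≡⟨ ring (+ k) A Y Q Q′ ⟩
    Q * (Y * (+ 3 * + suc k * Q′))        ≡⟨ cong (λ j → Q * (Y * (+ 3 * + suc k * q j))) (arg (+ k) A) ⟩
    Q * (Y * (+ 3 * + suc k * q (+ 3 * + suc k - + 3 - A))) ∎)
    where
    open ≡-Reasoning
    K = + 3 * + k
    Q = q (+ 3 * + suc k)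
    Q′ = q (K - A)
    N⁺ = numer (term (+ 3 * + suc k)) den (suc k)
    N = numer (term K) den (suc k)
    Y = prod (λ l → + 3 * + l * q (+ 3 * + l - + 3 - A)) k
    Z = (K - K) * (s + K - A - + 3 + + 3) * boundary K k
    γ = s + K - A - + 3 + K + + 6
    isolate : ∀ x y → x ≡ (x - y) + y
    isolate = solve-∀
    K-suc : ∀ x → + 3 * (+ 1 + x) ≡ + 3 * x + + 3
    K-suc = solve-∀
    vanish : ∀ γ v K b c Q Y d e →
      γ * (v * ((K - K) * b * c)) + Q * (Y * d + (K - K) * e * v) ≡ Q * (Y * d)
    vanish = solve-∀
    ring : ∀ x A Y Q Q′ → Q′ * (Y * (+ 3 * (+ 1 + x) * Q)) ≡ Q * (Y * (+ 3 * (+ 1 + x) * Q′))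
    ring = solve-∀
    arg : ∀ x A → + 3 * x - A ≡ + 3 * (+ 1 + x) - + 3 - A
    arg = solve-∀

-- Integer forms of the factors, and summation by parts

falling₃ : ℤ → ℤ
falling₃ x = x * (x - + 1) * (x - + 2)

cℤ : ℤ → ℤ → ℤ
cℤ n j = j * j + (+ 3 - + 3 * n) * j + + 3 * n * n - + 6 * n + + 2

lhsTerm : ℤ → ℕ → ℤ
lhsTerm n l = - falling₃ (n - + 3 * + l)

cShift : ℤ → ℤ → ℕ → ℤ
cShift n t l = cℤ n (n + + 3 * + l - t)

-- The term ratio of P'(1), as opposed to that of g(1).
balancedTerm : ℤ → ℕ → ℤ
balancedTerm n l = - ((n - + 3 * + l) * (n - + 3 * + l + + 1) * (n - + 3 * + l + + 2))

denom : ℤ → ℕ → ℤ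
denom n l = + 3 * + l * cℤ n (+ 3 * + l)

-- Formally, `balancedTerm n l` is `lhsTerm n (l - 1)` times `(n - 3l) / (n - 3(l - 1))`. The
-- fractions telescope, and index 0 contributes `- falling₃ n`.
prod-balanced : ∀ n L →
  n * prod (balancedTerm n) (suc L) ≡ - ((n - + 3 * + L - + 3) * falling₃ n * prod (lhsTerm n) L)
prod-balanced n zero = ring n
  where
  ring : ∀ n → n * (+ 1 * - ((n - + 3) * (n - + 3 + + 1) * (n - + 3 + + 2)))
         ≡ - ((n - + 0 - + 3) * (n * (n - + 1) * (n - + 2)) * + 1)
  ring = solve-∀
prod-balanced n (suc L) =
  trans (sym (*-assoc n (prod (balancedTerm n) (suc L)) _))
 (trans (cong (_* balancedTerm n (2 ℕ.+ L)) (prod-balanced n L))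
        (ring n (+ L) (falling₃ n) (prod (lhsTerm n) L)))
  where
  ring : ∀ n x N p → let y = n - + 3 * (+ 2 + x) ; z = n - + 3 * (+ 1 + x) in
    - ((n - + 3 * x - + 3) * N * p) * - (y * (y + + 1) * (y + + 2))
    ≡ - ((z - + 3) * N * (p * - (z * (z - + 1) * (z - + 2))))
  ring = solve-∀

by-parts : ∀ n L →
  n * numer (balancedTerm n) (denom n) L
    ≡ + 3 * numer (lhsTerm n) (denom n) L + (n - + 3 * + L - + 3) * prod (lhsTerm n) L
by-parts n zero = ring n
  where
  ring : ∀ n → n * + 1 ≡ + 3 * + 1 + (n - + 0 - + 3) * + 1
  ring = solve-∀
by-parts n (suc L) = begin
  n * (NS * δ + PS)         ≡⟨ split n NS δ PS ⟩
  n * NS * δ + n * PS       ≡⟨ cong₂ (λ x y → x * δ + y) (by-parts n L) (prod-balanced n L) ⟩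
  _                         ≡⟨ ring n (+ L) NT PT ⟩
  + 3 * (NT * δ + PT * lhsTerm n (suc L)) + (n - + 3 * + suc L - + 3) * (PT * lhsTerm n (suc L)) ∎
  where
  open ≡-Reasoning
  NS = numer (balancedTerm n) (denom n) L
  NT = numer (lhsTerm n) (denom n) L
  PS = prod (balancedTerm n) (suc L)
  PT = prod (lhsTerm n) L
  δ = denom n (suc L)
  split : ∀ n N δ p → n * (N * δ + p) ≡ n * N * δ + n * p
  split = solve-∀
  ring : ∀ n x N p → let j = + 3 * (+ 1 + x) ; z = n - + 3 * (+ 1 + x)
                         δ = j * (j * j + (+ 3 - + 3 * n) * j + + 3 * n * n - + 6 * n + + 2)
                         t = - (z * (z - + 1) * (z - + 2)) in
    (+ 3 * N + (n - + 3 * x - + 3) * p) * δ + - ((n - + 3 * x - + 3) * (n * (n - + 1) * (n - + 2)) * p)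
    ≡ + 3 * (N * δ + p * t) + (n - + 3 * (+ 1 + x) - + 3) * (p * t)
  ring = solve-∀

-- Non-vanishing of c_j

0≤i*i : ∀ i → + 0 ℤ.≤ i * i
0≤i*i (+ zero)  = ≤-refl
0≤i*i +[1+ _ ]  = +≤+ ℕ.z≤n
0≤i*i -[1+ _ ]  = +≤+ ℕ.z≤n

-- Completing the square gives 4 c_j = (2j + 3 - 3n)² + (3n² - 6n - 1), whose last bracket is at
-- least 8 for n ≥ 3.
cℤ≢0 : ∀ k j → cℤ (+ 3 + + k) j ≢ + 0
cℤ≢0 k j cℤ≡0 = contradiction 8≤0 λ { (+≤+ ()) }
  where
  t = + 2 * j + + 3 - + 3 * (+ 3 + + k)
  square : ∀ k j → let n = + 3 + k ; t = + 2 * j + + 3 - + 3 * n in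
    + 4 * (j * j + (+ 3 - + 3 * n) * j + + 3 * n * n - + 6 * n + + 2)
    ≡ + 8 + (t * t + (+ 3 * (k * k) + + 12 * k))
  square = solve-∀
  12k : + 0 ℤ.≤ + 12 * + k
  12k = subst (+ 0 ℤ.≤_) (pos-* 12 k) (+≤+ ℕ.z≤n)
  3k² : + 0 ℤ.≤ + 3 * (+ k * + k)
  3k² = subst (+ 0 ℤ.≤_) (trans (pos-* 3 (k ℕ.* k)) (cong (+ 3 *_) (pos-* k k))) (+≤+ ℕ.z≤n)
  8≤0 : + 8 ℤ.≤ + 0
  8≤0 = subst (+ 8 ℤ.≤_) (trans (sym (square (+ k) j)) (cong (+ 4 *_) cℤ≡0))
          (+-monoʳ-≤ (+ 8) (+-mono-≤ (0≤i*i t) (+-mono-≤ 3k² 12k)))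

-- The numerator of the left-hand side by residue of n mod 3

-- `balancedTerm n l` is the product of 3l - n, 3l - n - 1 and 3l - n - 2. Exactly one of n, n + 1,
-- n + 2 is a multiple of 3; its factor terminates the series, and `A` comes from one of the other
-- two.
numer-balanced : ∀ n K A →
  (∀ j → cℤ n j ≢ + 0) →
  (∀ l → balancedTerm n l
       ≡ Saalschütz.term A (+ 3 - + 3 * n) (+ 3 * n * n - + 6 * n + + 2) (+ 3 * + K) l) →
  numer (balancedTerm n) (denom n) K
    ≡ prod (λ l → + 3 * + l) K * prod (λ l → cℤ n (+ 3 * + l - + 3 - A)) K
numer-balanced n K A c≢0 balanced≗term =
  trans (numer-cong balanced≗term (λ l → cong (+ 3 * + l *_) (sym (q≡cℤ (+ 3 * + l)))) K)
 (trans (sum-evaluation (λ l q≡0 → c≢0 (+ 3 * + suc l) (trans (sym (q≡cℤ (+ 3 * + suc l))) q≡0)) K)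
 (trans (prod-cong (λ l → cong (+ 3 * + l *_) (q≡cℤ (+ 3 * + l - + 3 - A))) K)
        (prod-* (λ l → + 3 * + l) (λ l → cℤ n (+ 3 * + l - + 3 - A)) K)))
  where
  open Saalschütz A (+ 3 - + 3 * n) (+ 3 * n * n - + 6 * n + + 2)
  ring : ∀ n j → j * j + (+ 3 - + 3 * n) * j + (+ 3 * n * n - + 6 * n + + 2)
         ≡ j * j + (+ 3 - + 3 * n) * j + + 3 * n * n - + 6 * n + + 2
  ring = solve-∀
  q≡cℤ : ∀ j → q j ≡ cℤ n j
  q≡cℤ = ring n

-- The terminating factor is 3l - n, and the boundary term of `by-parts` at `M` has the factor n -
-- 3M - 3 = 0. The prefactor `suc M` is n / 3.
numer-lhs₀ : ∀ M n → n ≡ + 3 * + M + + 3 → (∀ j → cℤ n j ≢ + 0) →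
  numer (lhsTerm n) (denom n) M ≡ + suc M * (prod (λ l → + 3 * + l) M * prod (cShift n (+ 2)) M)
numer-lhs₀ M n refl c≢0 = *-cancelˡ-≡ (+ 3) _ _ (begin
  + 3 * numer (lhsTerm n) (denom n) M
    ≡⟨ pad (+ M) _ _ ⟩
  + 3 * numer (lhsTerm n) (denom n) M + (n - + 3 * + M - + 3) * prod (lhsTerm n) M
    ≡⟨ by-parts n M ⟨
  n * numer (balancedTerm n) (denom n) M
    ≡⟨ cong (n *_) (numer-balanced n M (- n - + 1) c≢0 λ l → balanced≡term (+ l) (+ M)) ⟩
  n * (prod (λ l → + 3 * + l) M * prod (λ l → cℤ n (+ 3 * + l - + 3 - (- n - + 1))) M)
    ≡⟨ cong (λ y → n * (prod (λ l → + 3 * + l) M * y))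
         (prod-cong (λ l → cong (cℤ n) (arg n (+ l))) M) ⟩
  n * Y ≡⟨ factor (+ M) Y ⟩
  + 3 * (+ suc M * Y) ∎)
  where
  open ≡-Reasoning
  Y = prod (λ l → + 3 * + l) M * prod (cShift n (+ 2)) M
  pad : ∀ m x p → + 3 * x ≡ + 3 * x + (+ 3 * m + + 3 - + 3 * m - + 3) * p
  pad = solve-∀
  factor : ∀ m y → (+ 3 * m + + 3) * y ≡ + 3 * ((+ 1 + m) * y)
  factor = solve-∀
  arg : ∀ n x → + 3 * x - + 3 - (- n - + 1) ≡ n + + 3 * x - + 2
  arg = solve-∀
  balanced≡term : ∀ x m → let n = + 3 * m + + 3 ; A = - n - + 1 ; y = n - + 3 * x in
    - (y * (y + + 1) * (y + + 2))
    ≡ (+ 3 * x - + 3 - + 3 * m) * (A + + 3 * x) * (+ 3 - + 3 * n + + 3 * m - A - + 3 + + 3 * x)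
  balanced≡term = solve-∀

-- When 3 ∤ n, the balanced sum has one term more than the left-hand side; the factor
-- c_{3(M+1)} = n z in its denominator is absorbed by the first factor c_n = 3(M+1) z of the product.
numer-lhs₊ : ∀ M n z → n ≢ + 0 → z ≢ + 0 → (∀ j → cℤ n j ≢ + 0) →
  lhsTerm n (suc M) ≡ + 0 →
  cℤ n (+ 3 * + suc M) ≡ n * z →
  cℤ n n ≡ z * (+ 3 * + suc M) →
  (∀ l → balancedTerm n l
       ≡ Saalschütz.term (- n) (+ 3 - + 3 * n) (+ 3 * n * n - + 6 * n + + 2) (+ 3 * + suc M) l) →
  numer (lhsTerm n) (denom n) M ≡ + suc M * (prod (λ l → + 3 * + l) M * prod (cShift n (+ 0)) M)
numer-lhs₊ M n z n≢0 z≢0 c≢0 lhsTerm≡0 c-last c-first balanced≗term =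
  *-cancelˡ-≡ z _ _ {{≢-nonZero z≢0}} (*-cancelˡ-≡ n _ _ {{≢-nonZero n≢0}}
  (*-cancelˡ-≡ (+ suc M) _ _ (*-cancelˡ-≡ (+ 9) _ _ (begin
  + 9 * (+ suc M * (n * (z * NT)))
    -- As `lhsTerm n (suc M)` is 0, passing from `M` to `suc M` only multiplies the numerator by
    -- 3(M+1) n z.
    ≡⟨ ring₁ NT (+ suc M) n z PT (n - + 3 * + suc M - + 3) ⟩
  + 3 * (NT * (+ 3 * + suc M * (n * z)) + PT * + 0) + (n - + 3 * + suc M - + 3) * (PT * + 0)
    ≡⟨ cong₂ (λ c t → + 3 * (NT * (+ 3 * + suc M * c) + PT * t) + (n - + 3 * + suc M - + 3) * (PT * t))
         (sym c-last) (sym lhsTerm≡0) ⟩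
  + 3 * numer (lhsTerm n) (denom n) (suc M) + (n - + 3 * + suc M - + 3) * prod (lhsTerm n) (suc M)
    ≡⟨ by-parts n (suc M) ⟨
  n * numer (balancedTerm n) (denom n) (suc M)
    ≡⟨ cong (n *_) (numer-balanced n (suc M) (- n) c≢0 balanced≗term) ⟩
  n * (P3 * (+ 3 * + suc M) * prod (λ l → cℤ n (+ 3 * + l - + 3 - - n)) (suc M))
    ≡⟨ cong (λ y → n * (P3 * (+ 3 * + suc M) * y)) (prod-head _ M) ⟩
  n * (P3 * (+ 3 * + suc M) * (cℤ n (+ 0 - - n) * prod (λ l → cℤ n (+ 3 * + suc l - + 3 - - n)) M))
    ≡⟨ cong₂ (λ u v → n * (P3 * (+ 3 * + suc M) * (u * v)))
         (trans (cong (cℤ n) (0--n n)) c-first)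
         (prod-cong (λ l → cong (cℤ n) (arg n (+ l))) M) ⟩
  n * (P3 * (+ 3 * + suc M) * (z * (+ 3 * + suc M) * Pc))
    ≡⟨ ring₂ n z (+ suc M) P3 Pc ⟩
  + 9 * (+ suc M * (n * (z * (+ suc M * (P3 * Pc))))) ∎))))
  where
  open ≡-Reasoning
  NT = numer (lhsTerm n) (denom n) M
  PT = prod (lhsTerm n) M
  P3 = prod (λ l → + 3 * + l) M
  Pc = prod (cShift n (+ 0)) M
  ring₁ : ∀ N x n z p w → + 9 * (x * (n * (z * N))) ≡ + 3 * (N * (+ 3 * x * (n * z)) + p * + 0) + w * (p * + 0)
  ring₁ = solve-∀
  ring₂ : ∀ n z x p q → n * (p * (+ 3 * x) * (z * (+ 3 * x) * q)) ≡ + 9 * (x * (n * (z * (x * (p * q)))))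
  ring₂ = solve-∀
  0--n : ∀ n → + 0 - - n ≡ n
  0--n = solve-∀
  arg : ∀ n x → + 3 * (+ 1 + x) - + 3 - - n ≡ n + + 3 * x - + 0
  arg = solve-∀

-- Here n - 3(M+1) = 1 is a root of `falling₃`. Hence j c_j equals `falling₃ n` at j = n - 1 and at
-- j = n, which forces z = n - 2. The terminating factor is 3l - n - 2.
numer-lhs₁ : ∀ M n → n ≡ + 3 * + M + + 4 → n ≢ + 0 → n - + 2 ≢ + 0 → (∀ j → cℤ n j ≢ + 0) →
  numer (lhsTerm n) (denom n) M ≡ + suc M * (prod (λ l → + 3 * + l) M * prod (cShift n (+ 0)) M)
numer-lhs₁ M n refl n≢0 z≢0 c≢0 =
  numer-lhs₊ M n (n - + 2) n≢0 z≢0 c≢0 (lhsTerm≡0 (+ M)) (c-last (+ M)) (c-first (+ M))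
    (λ l → balanced≡term (+ l) (+ M))
  where
  lhsTerm≡0 : ∀ m → let y = + 3 * m + + 4 - + 3 * (+ 1 + m) in - (y * (y - + 1) * (y - + 2)) ≡ + 0
  lhsTerm≡0 = solve-∀
  c-last : ∀ m → let n = + 3 * m + + 4 ; j = + 3 * (+ 1 + m) in
    j * j + (+ 3 - + 3 * n) * j + + 3 * n * n - + 6 * n + + 2 ≡ n * (n - + 2)
  c-last = solve-∀
  c-first : ∀ m → let n = + 3 * m + + 4 in
    n * n + (+ 3 - + 3 * n) * n + + 3 * n * n - + 6 * n + + 2 ≡ (n - + 2) * (+ 3 * (+ 1 + m))
  c-first = solve-∀
  balanced≡term : ∀ x m → let n = + 3 * m + + 4 ; A = - n ; y = n - + 3 * x ; K = + 3 * (+ 1 + m) in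
    - (y * (y + + 1) * (y + + 2))
    ≡ (+ 3 * x - + 3 - K) * (A + + 3 * x) * (+ 3 - + 3 * n + K - A - + 3 + + 3 * x)
  balanced≡term = solve-∀

-- Now n - 3(M+1) = 2 is the root, so c_{n-2} = n(n - 1) and z = n - 1. The terminating factor is 3l
-- - n - 1.
numer-lhs₂ : ∀ M n → n ≡ + 3 * + M + + 5 → n ≢ + 0 → n - + 1 ≢ + 0 → (∀ j → cℤ n j ≢ + 0) →
  numer (lhsTerm n) (denom n) M ≡ + suc M * (prod (λ l → + 3 * + l) M * prod (cShift n (+ 0)) M)
numer-lhs₂ M n refl n≢0 z≢0 c≢0 =
  numer-lhs₊ M n (n - + 1) n≢0 z≢0 c≢0 (lhsTerm≡0 (+ M)) (c-last (+ M)) (c-first (+ M))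
    (λ l → balanced≡term (+ l) (+ M))
  where
  lhsTerm≡0 : ∀ m → let y = + 3 * m + + 5 - + 3 * (+ 1 + m) in - (y * (y - + 1) * (y - + 2)) ≡ + 0
  lhsTerm≡0 = solve-∀
  c-last : ∀ m → let n = + 3 * m + + 5 ; j = + 3 * (+ 1 + m) in
    j * j + (+ 3 - + 3 * n) * j + + 3 * n * n - + 6 * n + + 2 ≡ n * (n - + 1)
  c-last = solve-∀
  c-first : ∀ m → let n = + 3 * m + + 5 in
    n * n + (+ 3 - + 3 * n) * n + + 3 * n * n - + 6 * n + + 2 ≡ (n - + 1) * (+ 3 * (+ 1 + m))
  c-first = solve-∀
  balanced≡term : ∀ x m → let n = + 3 * m + + 5 ; A = - n ; y = n - + 3 * x ; K = + 3 * (+ 1 + m) in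
    - (y * (y + + 1) * (y + + 2))
    ≡ (+ 3 * x - + 3 - K) * (A + + 3 * x) * (+ 3 - + 3 * n + K - A - + 3 + + 3 * x)
  balanced≡term = solve-∀

-- Integers inside ℚ and clearing of denominators

ι : ℤ → ℚ
ι z = z ℚ./ 1

-- Normalisation of `z / 1` is stuck on a variable `z`; the explicit normal form lets rational
-- arithmetic compute.
ι-mkℚ : ∀ z → ι z ≡ mkℚ z 0 (coprime-sym (1-coprimeTo ∣ z ∣))
ι-mkℚ z = ℚ.↥p/↧p≡p (mkℚ z 0 _)

ι-+ : ∀ x y → ι (x + y) ≡ ι x ℚ.+ ι y
ι-+ x y = trans (cong₂ (λ u v → ι (u + v)) (sym (*-identityʳ x)) (sym (*-identityʳ y)))
                (sym (cong₂ ℚ._+_ (ι-mkℚ x) (ι-mkℚ y)))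

ι-* : ∀ x y → ι (x * y) ≡ ι x ℚ.* ι y
ι-* x y = sym (cong₂ ℚ._*_ (ι-mkℚ x) (ι-mkℚ y))

ι-neg : ∀ x → ι (- x) ≡ ℚ.- ι x
ι-neg +0       = refl
ι-neg +[1+ _ ] = refl
ι-neg -[1+ n ] = trans (ι-mkℚ +[1+ n ]) (sym (cong ℚ.-_ (ι-mkℚ -[1+ n ])))

ι≢0 : ∀ {z} → z ≢ + 0 → ι z ≢ 0ℚ
ι≢0 {z} z≢0 ιz≡0 = z≢0 (cong ℚ.↥_ (trans (sym (ι-mkℚ z)) ιz≡0))

/6*6 : ∀ z → z ℚ./ 6 ℚ.* ι (+ 6) ≡ ι z
/6*6 z = ℚ.toℚᵘ-injective (begin
  ℚ.toℚᵘ (z ℚ./ 6 ℚ.* ι (+ 6))              ≈⟨ ℚ.toℚᵘ-homo-* (z ℚ./ 6) (ι (+ 6)) ⟩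
  ℚ.toℚᵘ (z ℚ./ 6) ℚᵘ.* ℚ.toℚᵘ (ι (+ 6))    ≈⟨ ℚᵘ.*-congʳ (ℚ.toℚᵘ-fromℚᵘ (ℚᵘ.mkℚᵘ z 5)) ⟩
  ℚᵘ.mkℚᵘ z 5 ℚᵘ.* ℚᵘ.mkℚᵘ (+ 6) 0          ≈⟨ ℚᵘ.*≡* (*-identityʳ (z * + 6)) ⟩
  ℚᵘ.mkℚᵘ z 0                               ≈⟨ ℚ.toℚᵘ-fromℚᵘ (ℚᵘ.mkℚᵘ z 0) ⟨
  ℚ.toℚᵘ (ι z)                              ∎)
  where open ℚᵘ.≃-Reasoning

*-cancelʳ : ∀ {x y z} → z ≢ 0ℚ → x ℚ.* z ≡ y ℚ.* z → x ≡ y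
*-cancelʳ {x} {y} {z} z≢0 eq = begin
  x                         ≡⟨ undo x ⟨
  x ℚ.* z ℚ.* (ℚ.1/ z)      ≡⟨ cong (ℚ._* (ℚ.1/ z)) eq ⟩
  y ℚ.* z ℚ.* (ℚ.1/ z)      ≡⟨ undo y ⟩
  y                         ∎
  where
  open ≡-Reasoning
  instance _ = ℚ.≢-nonZero z≢0
  undo : ∀ w → w ℚ.* z ℚ.* (ℚ.1/ z) ≡ w
  undo w = trans (ℚ.*-assoc w z _) (trans (cong (w ℚ.*_) (ℚ.*-inverseʳ z)) (ℚ.*-identityʳ w))

div-* : ∀ p {q} → q ≢ 0ℚ → div p q ℚ.* q ≡ p
div-* p {q} q≢0 with q ℚ.≟ 0ℚ
... | yes q≡0 = contradiction q≡0 q≢0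
... | no  q≢0 = trans (ℚ.*-assoc p _ q) (trans (cong (p ℚ.*_) (ℚ.*-inverseˡ q)) (ℚ.*-identityʳ p))
  where instance _ = ℚ.≢-nonZero q≢0

prodQ-++ : ∀ xs ys g → prodQ (xs ++ ys) g ≡ prodQ xs g ℚ.* prodQ ys g
prodQ-++ []       ys g = sym (ℚ.*-identityˡ _)
prodQ-++ (x ∷ xs) ys g = trans (cong (g x ℚ.*_) (prodQ-++ xs ys g)) (sym (ℚ.*-assoc (g x) _ _))

prodQ-∷ʳ : ∀ xs x g → prodQ (xs ∷ʳ x) g ≡ prodQ xs g ℚ.* g x
prodQ-∷ʳ xs x g = trans (prodQ-++ xs (x ∷ []) g) (cong (prodQ xs g ℚ.*_) (ℚ.*-identityʳ (g x)))

sumQ-∷ʳ : ∀ xs x g → sumQ (xs ∷ʳ x) g ≡ sumQ xs g ℚ.+ g x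
sumQ-∷ʳ []       x g = ℚ.+-comm (g x) 0ℚ
sumQ-∷ʳ (y ∷ xs) x g = trans (cong (g y ℚ.+_) (sumQ-∷ʳ xs x g)) (sym (ℚ.+-assoc (g y) _ _))

binom3-*6 : ∀ x → binom3 x ℚ.* ι (+ 6) ≡ ι (falling₃ x)
binom3-*6 x = /6*6 (falling₃ x)

ratio : ℕ → ℕ → ℚ
ratio n j = div (ℚ.- binom3 (+ n - + (3 ℕ.* j))) (binom3 (+ n) ℚ.- binom3 (+ n - + (3 ℕ.* j)))

-- Multiplying numerator and denominator by 6 turns binomials into falling factorials, and f(n) -
-- f(n - j) = j c_j is used at 3j.
ratio-* : ∀ n j → denom (+ n) j ≢ + 0 → ratio n j ℚ.* ι (denom (+ n) j) ≡ ι (lhsTerm (+ n) j)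
ratio-* n j denom≢0 = begin
  r ℚ.* ι (denom (+ n) j)           ≡⟨ cong (r ℚ.*_) denom≡ ⟨
  r ℚ.* ((b ℚ.- b′) ℚ.* ι6)     ≡⟨ ℚ.*-assoc r _ _ ⟨
  r ℚ.* (b ℚ.- b′) ℚ.* ι6       ≡⟨ cong (ℚ._* ι6) (div-* (ℚ.- b′) b-b′≢0) ⟩
  (ℚ.- b′) ℚ.* ι6               ≡⟨ ℚ.neg-distribˡ-* b′ ι6 ⟨
  ℚ.- (b′ ℚ.* ι6)               ≡⟨ cong ℚ.-_ (binom3-*6 y) ⟩
  ℚ.- ι (falling₃ (+ n - + (3 ℕ.* j))) ≡⟨ ι-neg (falling₃ y) ⟨
  ι (- falling₃ (+ n - + (3 ℕ.* j)))   ≡⟨ cong (λ x → ι (- falling₃ (+ n - x))) (pos-* 3 j) ⟩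
  ι (lhsTerm (+ n) j)                 ∎
  where
  open ≡-Reasoning
  y = + n - + (3 ℕ.* j)
  b = binom3 (+ n)
  b′ = binom3 y
  r = ratio n j
  ι6 = ι (+ 6)
  ring : ∀ n j → n * (n - + 1) * (n - + 2) - (n - j) * (n - j - + 1) * (n - j - + 2)
         ≡ j * (j * j + (+ 3 - + 3 * n) * j + + 3 * n * n - + 6 * n + + 2)
  ring = solve-∀
  denom≡ : (b ℚ.- b′) ℚ.* ι6 ≡ ι (denom (+ n) j)
  denom≡ = begin
    (b ℚ.- b′) ℚ.* ι6                            ≡⟨ ℚ.*-distribʳ-+ ι6 b (ℚ.- b′) ⟩
    b ℚ.* ι6 ℚ.+ (ℚ.- b′) ℚ.* ι6                 ≡⟨ cong (b ℚ.* ι6 ℚ.+_) (ℚ.neg-distribˡ-* b′ ι6) ⟨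
    b ℚ.* ι6 ℚ.- b′ ℚ.* ι6                       ≡⟨ cong₂ ℚ._-_ (binom3-*6 (+ n)) (binom3-*6 y) ⟩
    ι (falling₃ (+ n)) ℚ.- ι (falling₃ (+ n - + (3 ℕ.* j)))
      ≡⟨ cong (ι (falling₃ (+ n)) ℚ.+_) (ι-neg (falling₃ y)) ⟨
    ι (falling₃ (+ n)) ℚ.+ ι (- falling₃ (+ n - + (3 ℕ.* j)))  ≡⟨ ι-+ (falling₃ (+ n)) (- falling₃ y) ⟨
    ι (falling₃ (+ n) - falling₃ (+ n - + (3 ℕ.* j)))
      ≡⟨ cong (λ x → ι (falling₃ (+ n) - falling₃ (+ n - x))) (pos-* 3 j) ⟩
    ι (falling₃ (+ n) - falling₃ (+ n - + 3 * + j))            ≡⟨ cong ι (ring (+ n) (+ 3 * + j)) ⟩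
    ι (denom (+ n) j)                                ∎
  -- This rules out the default value 0 of `div`.
  b-b′≢0 : b ℚ.- b′ ≢ 0ℚ
  b-b′≢0 eq = ι≢0 denom≢0 (trans (sym denom≡) (trans (cong (ℚ._* ι6) eq) (ℚ.*-zeroˡ ι6)))

module _ (ρ : ℕ → ℚ) (a d : ℕ → ℤ) (ρ-* : ∀ l → ρ (suc l) ℚ.* ι (d (suc l)) ≡ ι (a (suc l))) where

  prodQ-prod : ∀ k → prodQ (range 1 k) ρ ℚ.* ι (prod d k) ≡ ι (prod a k)
  prodQ-prod zero    = refl
  prodQ-prod (suc k) = begin
    prodQ (range 1 (suc k)) ρ ℚ.* ι (prod d k * d (suc k))
      ≡⟨ cong₂ ℚ._*_ (trans (cong (λ xs → prodQ xs ρ) (sym (applyUpTo-∷ʳ (1 ℕ.+_) k)))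
                            (prodQ-∷ʳ (range 1 k) (suc k) ρ)) (ι-* (prod d k) _) ⟩
    P ℚ.* ρ (suc k) ℚ.* (ι (prod d k) ℚ.* ι (d (suc k)))
      ≡⟨ solve 4 (λ x y z w → x :* y :* (z :* w) := x :* z :* (y :* w)) refl P (ρ (suc k)) _ _ ⟩
    P ℚ.* ι (prod d k) ℚ.* (ρ (suc k) ℚ.* ι (d (suc k)))
      ≡⟨ cong₂ ℚ._*_ (prodQ-prod k) (ρ-* k) ⟩
    ι (prod a k) ℚ.* ι (a (suc k))
      ≡⟨ ι-* (prod a k) _ ⟨
    ι (prod a (suc k)) ∎
    where
    open ≡-Reasoning
    open +-*-Solver
    P = prodQ (range 1 k) ρ

  sumQ-numer : ∀ k → sumQ (range 0 k) (λ i → prodQ (range 1 i) ρ) ℚ.* ι (prod d k) ≡ ι (numer a d k)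
  sumQ-numer zero    = refl
  sumQ-numer (suc k) = begin
    sumQ (range 0 (suc k)) g ℚ.* ι (prod d (suc k))
      ≡⟨ cong (ℚ._* ι (prod d (suc k)))
         (trans (cong (λ xs → sumQ xs g) (sym (applyUpTo-∷ʳ (0 ℕ.+_) (suc k))))
                (sumQ-∷ʳ (range 0 k) (suc k) g)) ⟩
    (Σ ℚ.+ g (suc k)) ℚ.* ι (prod d (suc k))
      ≡⟨ ℚ.*-distribʳ-+ _ Σ _ ⟩
    Σ ℚ.* ι (prod d k * d (suc k)) ℚ.+ g (suc k) ℚ.* ι (prod d (suc k))
      ≡⟨ cong₂ ℚ._+_ (trans (cong (Σ ℚ.*_) (ι-* (prod d k) _)) (sym (ℚ.*-assoc Σ _ _)))
                     (prodQ-prod (suc k)) ⟩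
    Σ ℚ.* ι (prod d k) ℚ.* ι (d (suc k)) ℚ.+ ι (prod a (suc k))
      ≡⟨ cong (λ x → x ℚ.* ι (d (suc k)) ℚ.+ ι (prod a (suc k))) (sumQ-numer k) ⟩
    ι (numer a d k) ℚ.* ι (d (suc k)) ℚ.+ ι (prod a (suc k))
      ≡⟨ cong (ℚ._+ ι (prod a (suc k))) (ι-* (numer a d k) _) ⟨
    ι (numer a d k * d (suc k)) ℚ.+ ι (prod a (suc k))
      ≡⟨ ι-+ (numer a d k * d (suc k)) _ ⟨
    ι (numer a d (suc k)) ∎
    where
    open ≡-Reasoning
    g = λ i → prodQ (range 1 i) ρ
    Σ = sumQ (range 0 k) g

prod≢0 : ∀ a → (∀ l → a (suc l) ≢ + 0) → ∀ k → prod a k ≢ + 0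
prod≢0 a a≢0 zero    ()
prod≢0 a a≢0 (suc k) eq = [ prod≢0 a a≢0 k , a≢0 k ]′ (i*j≡0⇒i≡0∨j≡0 (prod a k) eq)

-- Products over filtered ranges

module _ {P : Pred ℕ 0ℓ} (P? : Decidable P) (s : ℕ) (g : ℕ → ℚ) where

  -- Indexed by the length of the range, so that it grows on the right one candidate at a time.
  filterProd : ℕ → ℚ
  filterProd k = prodQ (filter P? (applyUpTo (s ℕ.+_) k)) g

  private
    snoc : ∀ k → filter P? (applyUpTo (s ℕ.+_) (suc k)) ≡
           filter P? (applyUpTo (s ℕ.+_) k) ++ filter P? (s ℕ.+ k ∷ [])
    snoc k = trans (cong (filter P?) (sym (applyUpTo-∷ʳ (s ℕ.+_) k))) (filter-++ P? (applyUpTo (s ℕ.+_) k) _)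

  filterProd-accept : ∀ k → P (s ℕ.+ k) → filterProd (suc k) ≡ filterProd k ℚ.* g (s ℕ.+ k)
  filterProd-accept k Pk =
    trans (cong (λ xs → prodQ xs g) (trans (snoc k)
            (cong (filter P? (applyUpTo (s ℕ.+_) k) ++_) (filter-accept P? Pk))))
          (prodQ-∷ʳ (filter P? (applyUpTo (s ℕ.+_) k)) (s ℕ.+ k) g)

  filterProd-reject : ∀ k → ¬ P (s ℕ.+ k) → filterProd (suc k) ≡ filterProd k
  filterProd-reject k ¬Pk =
    cong (λ xs → prodQ xs g) (trans (snoc k)
      (trans (cong (filter P? (applyUpTo (s ℕ.+_) k) ++_) (filter-reject P? ¬Pk)) (++-identityʳ _)))

-- Reflection about the centre of symmetry

-- The two roots of c_j in j have sum 3n - 3.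
cℤ-reflect : ∀ n j → cℤ n (+ 3 * n - + 3 - j) ≡ cℤ n j
cℤ-reflect = ring
  where
  ring : ∀ n j → (+ 3 * n - + 3 - j) * (+ 3 * n - + 3 - j)
           + (+ 3 - + 3 * n) * (+ 3 * n - + 3 - j) + + 3 * n * n - + 6 * n + + 2
         ≡ j * j + (+ 3 - + 3 * n) * j + + 3 * n * n - + 6 * n + + 2
  ring = solve-∀

-- By hypothesis `b` lists the factors of `a` backwards from index `M`, so each factor of `b` can be
-- handed over to extend `prod a` until it reaches `M`.
prod-reflect : ∀ a b M → (∀ x y → x ℕ.+ y ≡ M → b (suc y) ≡ a x) →
  ∀ x y → x ℕ.+ y ≡ M → prod a x * prod b y ≡ prod a M
prod-reflect a b M refl-ab x zero    x+0≡M =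
  trans (*-identityʳ _) (cong (prod a) (trans (sym (ℕ.+-identityʳ x)) x+0≡M))
prod-reflect a b M refl-ab x (suc y) x+y≡M = begin
  prod a x * (prod b y * b (suc y))
    ≡⟨ cong (λ z → prod a x * (prod b y * z)) (refl-ab (suc x) y x+y≡M′) ⟩
  prod a x * (prod b y * a (suc x))   ≡⟨ swap (prod a x) (prod b y) (a (suc x)) ⟩
  prod a (suc x) * prod b y           ≡⟨ prod-reflect a b M refl-ab (suc x) y x+y≡M′ ⟩
  prod a M                            ∎
  where
  open ≡-Reasoning
  x+y≡M′ : suc x ℕ.+ y ≡ M
  x+y≡M′ = trans (sym (ℕ.+-suc x y)) x+y≡M
  swap : ∀ x y z → x * (y * z) ≡ x * z * y
  swap = solve-∀

-- Products over multiples and non-multiples of 3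

3∤1+r+k*3 : ∀ r k → r ℕ.< 2 → ¬ 3 ∣ suc r ℕ.+ k ℕ.* 3
3∤1+r+k*3 r k r<2 3∣ =
  >⇒∤ (s≤s r<2) (∣m+n∣m⇒∣n (subst (3 ∣_) (ℕ.+-comm (suc r) (k ℕ.* 3)) 3∣) (n∣m*n k))

3∤1+k*3 : ∀ k → ¬ 3 ∣ 1 ℕ.+ k ℕ.* 3
3∤1+k*3 k = 3∤1+r+k*3 0 k (s≤s z≤n)

3∤2+k*3 : ∀ k → ¬ 3 ∣ 2 ℕ.+ k ℕ.* 3
3∤2+k*3 k = 3∤1+r+k*3 1 k (s≤s (s≤s z≤n))

module Multiples (n : ℕ) where

  g : ℕ → ℚ
  g j = c n (+ j)

  F : ℕ → ℚ
  F = filterProd (3 ∣?_) 3 g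

  c₃ : ℕ → ℤ
  c₃ l = cℤ (+ n) (+ 3 * + l)

  c-multiple : ∀ l → c n (+ (l ℕ.* 3)) ≡ ι (c₃ l)
  c-multiple l = cong (λ j → ι (cℤ (+ n) j)) (trans (pos-* l 3) (*-comm (+ l) (+ 3)))

  skip₁ : ∀ k → F (2 ℕ.+ k ℕ.* 3) ≡ F (1 ℕ.+ k ℕ.* 3)
  skip₁ k = filterProd-reject (3 ∣?_) 3 g (1 ℕ.+ k ℕ.* 3) (3∤1+k*3 (suc k))

  skip₂ : ∀ k → F (3 ℕ.+ k ℕ.* 3) ≡ F (2 ℕ.+ k ℕ.* 3)
  skip₂ k = filterProd-reject (3 ∣?_) 3 g (2 ℕ.+ k ℕ.* 3) (3∤2+k*3 (suc k))

  -- The candidates run from 3 to 3(k + 1), ending exactly on a multiple.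
  F-prod : ∀ k → F (1 ℕ.+ k ℕ.* 3) ≡ ι (prod c₃ (suc k))
  F-prod zero    = trans (ℚ.*-identityʳ _) (cong ι (sym (*-identityˡ (c₃ 1))))
  F-prod (suc k) = begin
    F (4 ℕ.+ k ℕ.* 3)
      ≡⟨ filterProd-accept (3 ∣?_) 3 g (3 ℕ.+ k ℕ.* 3) (n∣m*n (2 ℕ.+ k)) ⟩
    F (3 ℕ.+ k ℕ.* 3) ℚ.* c n (+ ((2 ℕ.+ k) ℕ.* 3))
      ≡⟨ cong₂ ℚ._*_ (trans (skip₂ k) (trans (skip₁ k) (F-prod k))) (c-multiple (2 ℕ.+ k)) ⟩
    ι (prod c₃ (suc k)) ℚ.* ι (c₃ (2 ℕ.+ k))
      ≡⟨ ι-* (prod c₃ (suc k)) _ ⟨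
    ι (prod c₃ (2 ℕ.+ k)) ∎
    where open ≡-Reasoning

module NonMultiples (n : ℕ) where

  g : ℕ → ℚ
  g j = c n (+ j)

  F : ℕ → ℚ
  F = filterProd (λ j → ¬? (3 ∣? j)) (suc n) g

  skip : ∀ i q → suc n ℕ.+ i ≡ q ℕ.* 3 → F (suc i) ≡ F i
  skip i q eq = filterProd-reject (λ j → ¬? (3 ∣? j)) (suc n) g i
    λ 3∤ → 3∤ (subst (3 ∣_) (sym eq) (n∣m*n q))

  -- Offset `r` in the v-th block of three after `n` belongs to the class of shift `2 - r`.
  position : ∀ r v → + (suc n ℕ.+ (r ℕ.+ v ℕ.* 3)) ≡ + n + + 3 * + suc v - (+ 2 - + r)
  position r v = trans (cong (λ x → + 1 + + n + (+ r + x)) (pos-* v 3)) (ring (+ n) (+ r) (+ v))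
    where
    ring : ∀ n r v → + 1 + n + (r + v * + 3) ≡ n + + 3 * (+ 1 + v) - (+ 2 - r)
    ring = solve-∀

  keep : ∀ r v → ¬ 3 ∣ suc n ℕ.+ (r ℕ.+ v ℕ.* 3) →
         F (suc (r ℕ.+ v ℕ.* 3)) ≡ F (r ℕ.+ v ℕ.* 3) ℚ.* ι (cShift (+ n) (+ 2 - + r) (suc v))
  keep r v 3∤ = trans (filterProd-accept (λ j → ¬? (3 ∣? j)) (suc n) g (r ℕ.+ v ℕ.* 3) 3∤)
                      (cong (λ j → F (r ℕ.+ v ℕ.* 3) ℚ.* ι (cℤ (+ n) j)) (position r v))

  -- Each block of three candidates keeps one index from each of two classes.
  blocks : ∀ a b → (∀ v → F (suc v ℕ.* 3) ≡ F (v ℕ.* 3) ℚ.* ι (a (suc v)) ℚ.* ι (b (suc v))) →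
           ∀ v → F (v ℕ.* 3) ≡ ι (prod a v * prod b v)
  blocks a b step zero    = refl
  blocks a b step (suc v) = begin
    F (suc v ℕ.* 3)                                                ≡⟨ step v ⟩
    F (v ℕ.* 3) ℚ.* ι (a (suc v)) ℚ.* ι (b (suc v))
      ≡⟨ cong (λ x → x ℚ.* ι (a (suc v)) ℚ.* ι (b (suc v))) (blocks a b step v) ⟩
    ι (prod a v * prod b v) ℚ.* ι (a (suc v)) ℚ.* ι (b (suc v))
      ≡⟨ cong (ℚ._* ι (b (suc v))) (ι-* (prod a v * prod b v) _) ⟨
    ι (prod a v * prod b v * a (suc v)) ℚ.* ι (b (suc v))
      ≡⟨ ι-* (prod a v * prod b v * a (suc v)) _ ⟨
    ι (prod a v * prod b v * a (suc v) * b (suc v))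
      ≡⟨ cong ι (swap (prod a v) (prod b v) (a (suc v)) (b (suc v))) ⟩
    ι (prod a (suc v) * prod b (suc v)) ∎
    where
    open ≡-Reasoning
    swap : ∀ x y u w → x * y * u * w ≡ x * u * (y * w)
    swap = solve-∀

-- Range lengths and reduction to integer products

quotient : ∀ r k m .{{_ : ℕ.NonZero m}} → r ℕ.< m → (r ℕ.+ k ℕ.* m) ℕ./ m ≡ k
quotient r k m r<m = trans (+-distrib-/-∣ʳ r (n∣m*n k)) (cong₂ ℕ._+_ (m<n⇒m/n≡0 r<m) (m*n/n≡m k m))

-- The range starts at n + 1, so its length is its upper end minus `n`; the equation exhibits the
-- division of 3n by 2 with remainder.
range-length : ∀ n k r → r ℕ.< 2 →
               3 ℕ.* n ≡ r ℕ.+ (2 ℕ.+ (n ℕ.+ k)) ℕ.* 2 → (3 ℕ.* n) ℕ./ 2 ∸ 2 ∸ n ≡ k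
range-length n k r r<2 eq =
  trans (cong (λ x → x ∸ 2 ∸ n) (trans (cong (ℕ._/ 2) eq) (quotient r (2 ℕ.+ (n ℕ.+ k)) 2 r<2)))
        (ℕ.m+n∸m≡n n k)

parity : ∀ M → (∃[ w ] M ≡ w ℕ.+ w) ⊎ (∃[ w ] M ≡ suc (w ℕ.+ w))
parity zero    = inj₁ (0 , refl)
parity (suc M) with parity M
... | inj₁ (w , eq) = inj₂ (w , cong suc eq)
... | inj₂ (w , eq) = inj₁ (suc w , trans (cong suc eq) (cong suc (sym (ℕ.+-suc w w))))

-- Both sides are multiplied by the product of all 3l c_{3l}. The product of the 3l matches the one
-- in the evaluated numerator, which leaves the quotient of the two c-products.
lhs≡rhs-from-products : ∀ n M a → n ℕ./ 3 ≡ suc M → (∀ j → cℤ (+ n) j ≢ + 0) →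
  numer (lhsTerm (+ n)) (denom (+ n)) M ≡ + suc M * (prod (λ l → + 3 * + l) M * prod a M) →
  NonMultiples.F n ((3 ℕ.* n) ℕ./ 2 ∸ 2 ∸ n) ≡ ι (prod a M) →
  Multiples.F n (suc (n ∸ 3) ∸ 3) ≡ ι (prod (Multiples.c₃ n) M) →
  lhs n ≡ rhs n
lhs≡rhs-from-products n M a n/3≡ c≢0 numer≡ num≡ den≡ = *-cancelʳ (ι≢0 (prod≢0 δ δ≢0 M)) (begin
  lhs n ℚ.* ι (prod δ M)
    ≡⟨ cong (λ q → sumQ (range 0 (q ∸ 1)) (λ i → prodQ (range 1 i) (ratio n)) ℚ.* ι (prod δ M)) n/3≡ ⟩
  sumQ (range 0 M) (λ i → prodQ (range 1 i) (ratio n)) ℚ.* ι (prod δ M)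
    ≡⟨ sumQ-numer (ratio n) (lhsTerm (+ n)) δ (λ l → ratio-* n (suc l) (δ≢0 l)) M ⟩
  ι (numer (lhsTerm (+ n)) δ M)                        ≡⟨ cong ι numer≡ ⟩
  ι (+ suc M * (P₃ * prod a M))
    ≡⟨ trans (ι-* (+ suc M) (P₃ * prod a M)) (cong (ι (+ suc M) ℚ.*_) (ι-* P₃ (prod a M))) ⟩
  ι (+ suc M) ℚ.* (ι P₃ ℚ.* ι (prod a M))
    ≡⟨ cong (λ x → ι (+ suc M) ℚ.* (ι P₃ ℚ.* x)) (div-* (ι (prod a M)) Pc≢0) ⟨
  ι (+ suc M) ℚ.* (ι P₃ ℚ.* (div (ι (prod a M)) (ι Pc) ℚ.* ι Pc))
    ≡⟨ solve 4 (λ m p x y → m :* (p :* (x :* y)) := m :* x :* (p :* y)) refl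
         (ι (+ suc M)) (ι P₃) (div (ι (prod a M)) (ι Pc)) (ι Pc) ⟩
  ι (+ suc M) ℚ.* div (ι (prod a M)) (ι Pc) ℚ.* (ι P₃ ℚ.* ι Pc)
    ≡⟨ cong₂ ℚ._*_ (cong₂ ℚ._*_ (cong (λ q → ι (+ q)) n/3≡) (cong₂ div num≡ den≡))
                   (trans (cong ι (prod-* (λ l → + 3 * + l) (Multiples.c₃ n) M)) (ι-* P₃ Pc)) ⟨
  rhs n ℚ.* ι (prod δ M) ∎)
  where
  open ≡-Reasoning
  open +-*-Solver
  δ = denom (+ n)
  P₃ = prod (λ l → + 3 * + l) M
  Pc = prod (Multiples.c₃ n) M
  δ≢0 : ∀ l → δ (suc l) ≢ + 0
  δ≢0 l eq = [ (λ ()) , c≢0 (+ 3 * + suc l) ]′ (i*j≡0⇒i≡0∨j≡0 (+ 3 * + suc l) eq)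
  Pc≢0 : ι Pc ≢ 0ℚ
  Pc≢0 = ι≢0 (prod≢0 (Multiples.c₃ n) (λ l → c≢0 (+ 3 * + suc l)) M)

-- Folding the numerator product onto the half range

n-eq : ∀ e M → + (3 ℕ.+ (e ℕ.+ M ℕ.* 3)) ≡ + 3 * + M + (+ 3 + + e)
n-eq e M = trans (cong (λ x → + 3 + (+ e + x)) (pos-* M 3)) (ring (+ e) (+ M))
  where
  ring : ∀ e m → + 3 + (e + m * + 3) ≡ + 3 * m + (+ 3 + e)
  ring = solve-∀

-- With n = 3M + 3 + e, reflection exchanges the classes of shifts `s` and `t` when s + t = 3 - e:
-- the pairs used are (1, 2), (2, 0) and (1, 0) for e = 0, 1, 2.
cShift-reflect : ∀ e M x y s t → s + t ≡ + 3 - + e → x ℕ.+ y ≡ M →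
  let n = + (3 ℕ.+ (e ℕ.+ M ℕ.* 3)) in cShift n s (suc y) ≡ cShift n t x
cShift-reflect e M x y s t s+t x+y≡M = trans (sym (cℤ-reflect n (n + + 3 * + suc y - s))) (cong (cℤ n) (begin
  + 3 * n - + 3 - (n + + 3 * + suc y - s)                      ≡⟨ ring₁ n (+ y) s t ⟩
  n + (n - + 6 - + 3 * + y + (s + t)) - t
    ≡⟨ cong₂ (λ u v → n + (u - + 6 - + 3 * + y + v) - t) n≡ s+t ⟩
  n + (+ 3 * (+ x + + y) + (+ 3 + + e) - + 6 - + 3 * + y + (+ 3 - + e)) - t ≡⟨ ring₂ n (+ x) (+ y) (+ e) t ⟩
  n + + 3 * + x - t ∎))
  where
  open ≡-Reasoning
  n = + (3 ℕ.+ (e ℕ.+ M ℕ.* 3))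
  n≡ : n ≡ + 3 * (+ x + + y) + (+ 3 + + e)
  n≡ = trans (n-eq e M) (cong (λ m → + 3 * + m + (+ 3 + + e)) (sym x+y≡M))
  ring₁ : ∀ n y s t → + 3 * n - + 3 - (n + + 3 * (+ 1 + y) - s) ≡ n + (n - + 6 - + 3 * y + (s + t)) - t
  ring₁ = solve-∀
  ring₂ : ∀ n x y e t → n + (+ 3 * (x + y) + (+ 3 + e) - + 6 - + 3 * y + (+ 3 - e)) - t ≡ n + + 3 * x - t
  ring₂ = solve-∀

-- Shows that the index at offset `r` is 1 + e + r mod 3, which decides the offset to be skipped.
index : ∀ e M r v →
        suc (3 ℕ.+ (e ℕ.+ M ℕ.* 3)) ℕ.+ (r ℕ.+ v ℕ.* 3)
        ≡ (1 ℕ.+ (e ℕ.+ r)) ℕ.+ (1 ℕ.+ (M ℕ.+ v)) ℕ.* 3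
index = ℕ-Solver.solve-∀

module Residue₀ (M : ℕ) where
  n = 3 ℕ.+ (0 ℕ.+ M ℕ.* 3)
  open NonMultiples n
  α = cShift (+ n) (+ 2)
  β = cShift (+ n) (+ 1)

  3∤₀ : ∀ v → ¬ 3 ∣ suc n ℕ.+ (0 ℕ.+ v ℕ.* 3)
  3∤₀ v = subst (λ j → ¬ 3 ∣ j) (sym (index 0 M 0 v)) (3∤1+k*3 (1 ℕ.+ (M ℕ.+ v)))

  3∤₁ : ∀ v → ¬ 3 ∣ suc n ℕ.+ (1 ℕ.+ v ℕ.* 3)
  3∤₁ v = subst (λ j → ¬ 3 ∣ j) (sym (index 0 M 1 v)) (3∤2+k*3 (1 ℕ.+ (M ℕ.+ v)))

  skip₂ : ∀ v → F (suc v ℕ.* 3) ≡ F (2 ℕ.+ v ℕ.* 3)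
  skip₂ v = skip (2 ℕ.+ v ℕ.* 3) (2 ℕ.+ (M ℕ.+ v)) (index 0 M 2 v)

  F-blocks : ∀ v → F (v ℕ.* 3) ≡ ι (prod α v * prod β v)
  F-blocks = blocks α β λ v → trans (skip₂ v)
    (trans (keep 1 v (3∤₁ v)) (cong (ℚ._* ι (β (suc v))) (keep 0 v (3∤₀ v))))

  reflect : ∀ x y → x ℕ.+ y ≡ M → prod α x * prod β y ≡ prod α M
  reflect = prod-reflect α β M λ x y → cShift-reflect 0 M x y (+ 1) (+ 2) refl

  F-even : ∀ w → M ≡ w ℕ.+ w → F (w ℕ.* 3) ≡ ι (prod α M)
  F-even w M≡ = trans (F-blocks w) (cong ι (reflect w w (sym M≡)))

  -- After `w` full blocks one more index of class `α` is kept, so w + 1 factors `α` meet w factors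
  -- `β`.
  F-odd : ∀ w → M ≡ suc (w ℕ.+ w) → F (1 ℕ.+ w ℕ.* 3) ≡ ι (prod α M)
  F-odd w M≡ = begin
    F (1 ℕ.+ w ℕ.* 3)                      ≡⟨ keep 0 w (3∤₀ w) ⟩
    F (w ℕ.* 3) ℚ.* ι (α (suc w))          ≡⟨ cong (ℚ._* ι (α (suc w))) (F-blocks w) ⟩
    ι (prod α w * prod β w) ℚ.* ι (α (suc w)) ≡⟨ ι-* (prod α w * prod β w) _ ⟨
    ι (prod α w * prod β w * α (suc w))    ≡⟨ cong ι (swap (prod α w) (prod β w) (α (suc w))) ⟩
    ι (prod α (suc w) * prod β w)          ≡⟨ cong ι (reflect (suc w) w (sym M≡)) ⟩
    ι (prod α M)                           ∎
    where
    open ≡-Reasoning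
    swap : ∀ x y z → x * y * z ≡ x * z * y
    swap = solve-∀

-- In the remaining residues, β precedes α in each block of three.
module Residue₊ (e M : ℕ) (β : ℕ → ℤ) where
  n = 3 ℕ.+ (e ℕ.+ M ℕ.* 3)
  open NonMultiples n
  α = cShift (+ n) (+ 0)

  module _ (step : ∀ v → F (suc v ℕ.* 3) ≡ F (v ℕ.* 3) ℚ.* ι (β (suc v)) ℚ.* ι (α (suc v)))
           (reflect-β : ∀ x y → x ℕ.+ y ≡ M → β (suc y) ≡ α x) where

    reflect : ∀ x y → x ℕ.+ y ≡ M → prod β y * prod α x ≡ prod α M
    reflect x y x+y≡M = trans (*-comm (prod β y) _) (prod-reflect α β M reflect-β x y x+y≡M)

    F-even : ∀ w → M ≡ w ℕ.+ w → F (w ℕ.* 3) ≡ ι (prod α M)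
    F-even w M≡ = trans (blocks β α step w) (cong ι (reflect w w (sym M≡)))

    F-odd : ∀ w → M ≡ suc (w ℕ.+ w) → F (w ℕ.* 3) ℚ.* ι (β (suc w)) ≡ ι (prod α M)
    F-odd w M≡ = begin
      F (w ℕ.* 3) ℚ.* ι (β (suc w))          ≡⟨ cong (ℚ._* ι (β (suc w))) (blocks β α step w) ⟩
      ι (prod β w * prod α w) ℚ.* ι (β (suc w)) ≡⟨ ι-* (prod β w * prod α w) _ ⟨
      ι (prod β w * prod α w * β (suc w))    ≡⟨ cong ι (swap (prod β w) (prod α w) (β (suc w))) ⟩
      ι (prod β (suc w) * prod α w)          ≡⟨ cong ι (reflect w (suc w) (trans (ℕ.+-suc w w) (sym M≡))) ⟩
      ι (prod α M)                           ∎
      where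
      open ≡-Reasoning
      swap : ∀ x y z → x * y * z ≡ x * z * y
      swap = solve-∀

-- The three residue classes and the theorem

-- The range ends at n - 3 = 3M; for `M = 0` truncated subtraction makes it empty.
den₀ : ∀ n M → Multiples.F n (suc (M ℕ.* 3) ∸ 3) ≡ ι (prod (Multiples.c₃ n) M)
den₀ n zero    = refl
den₀ n (suc M) = Multiples.F-prod n M

den₁ : ∀ n M → Multiples.F n (suc (1 ℕ.+ M ℕ.* 3) ∸ 3) ≡ ι (prod (Multiples.c₃ n) M)
den₁ n zero    = refl
den₁ n (suc M) = trans (Multiples.skip₁ n M) (Multiples.F-prod n M)

den₂ : ∀ n M → Multiples.F n (suc (2 ℕ.+ M ℕ.* 3) ∸ 3) ≡ ι (prod (Multiples.c₃ n) M)
den₂ n zero    = refl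
den₂ n (suc M) = trans (Multiples.skip₂ n M) (trans (Multiples.skip₁ n M) (Multiples.F-prod n M))

c≢0 : ∀ e M j → cℤ (+ (3 ℕ.+ (e ℕ.+ M ℕ.* 3))) j ≢ + 0
c≢0 e M = cℤ≢0 (e ℕ.+ M ℕ.* 3)

residue₀ : ∀ M → lhs (3 ℕ.+ M ℕ.* 3) ≡ rhs (3 ℕ.+ M ℕ.* 3)
residue₀ M = lhs≡rhs-from-products n M α (quotient 0 (suc M) 3 (s≤s z≤n)) (c≢0 0 M)
  (numer-lhs₀ M (+ n) (n-eq 0 M) (c≢0 0 M)) num (den₀ n M)
  where
  open Residue₀ M
  open NonMultiples n
  num : F ((3 ℕ.* n) ℕ./ 2 ∸ 2 ∸ n) ≡ ι (prod α M)
  num with parity M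
  -- For n = 3 the upper end 2 lies below the start 4, and truncation gives length 0.
  ... | inj₁ (zero , refl) = refl
  -- The range is one index short of `suc w` full blocks, and the missing index is a multiple of 3.
  ... | inj₁ (suc w , refl) = trans (cong F (range-length n (2 ℕ.+ w ℕ.* 3) 1 (s≤s (s≤s z≤n)) (ring w)))
      (trans (sym (skip₂ w)) (F-even (suc w) refl))
    where
    ring : ∀ w → 3 ℕ.* (3 ℕ.+ (suc w ℕ.+ suc w) ℕ.* 3)
           ≡ 1 ℕ.+ (2 ℕ.+ ((3 ℕ.+ (suc w ℕ.+ suc w) ℕ.* 3) ℕ.+ (2 ℕ.+ w ℕ.* 3))) ℕ.* 2
    ring = ℕ-Solver.solve-∀
  ... | inj₂ (w , refl) = trans (cong F (range-length n (1 ℕ.+ w ℕ.* 3) 0 (s≤s z≤n) (ring w)))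
      (F-odd w refl)
    where
    ring : ∀ w → 3 ℕ.* (3 ℕ.+ suc (w ℕ.+ w) ℕ.* 3)
           ≡ (2 ℕ.+ ((3 ℕ.+ suc (w ℕ.+ w) ℕ.* 3) ℕ.+ (1 ℕ.+ w ℕ.* 3))) ℕ.* 2
    ring = ℕ-Solver.solve-∀

residue₁ : ∀ M → lhs (4 ℕ.+ M ℕ.* 3) ≡ rhs (4 ℕ.+ M ℕ.* 3)
residue₁ M = lhs≡rhs-from-products n M α (quotient 1 (suc M) 3 (s≤s (s≤s z≤n))) (c≢0 1 M)
  (numer-lhs₁ M (+ n) (n-eq 1 M) (λ ()) (λ ()) (c≢0 1 M)) num (den₁ n M)
  where
  n = 4 ℕ.+ M ℕ.* 3
  α = cShift (+ n) (+ 0)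
  β = cShift (+ n) (+ 2)
  open NonMultiples n
  open Residue₊ 1 M β using (F-even; F-odd)

  3∤₀ : ∀ v → ¬ 3 ∣ suc n ℕ.+ (0 ℕ.+ v ℕ.* 3)
  3∤₀ v = subst (λ j → ¬ 3 ∣ j) (sym (index 1 M 0 v)) (3∤2+k*3 (1 ℕ.+ (M ℕ.+ v)))

  3∤₂ : ∀ v → ¬ 3 ∣ suc n ℕ.+ (2 ℕ.+ v ℕ.* 3)
  3∤₂ v = subst (λ j → ¬ 3 ∣ j) (sym (index 1 M 2 v)) (3∤1+k*3 (2 ℕ.+ (M ℕ.+ v)))

  step : ∀ v → F (suc v ℕ.* 3) ≡ F (v ℕ.* 3) ℚ.* ι (β (suc v)) ℚ.* ι (α (suc v))
  step v = trans (keep 2 v (3∤₂ v)) (cong (ℚ._* ι (α (suc v)))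
    (trans (skip (1 ℕ.+ v ℕ.* 3) (2 ℕ.+ (M ℕ.+ v)) (index 1 M 1 v)) (keep 0 v (3∤₀ v))))

  reflect-β : ∀ x y → x ℕ.+ y ≡ M → β (suc y) ≡ α x
  reflect-β x y = cShift-reflect 1 M x y (+ 2) (+ 0) refl

  num : F ((3 ℕ.* n) ℕ./ 2 ∸ 2 ∸ n) ≡ ι (prod α M)
  num with parity M
  ... | inj₁ (w , refl) = trans (cong F (range-length n (w ℕ.* 3) 0 (s≤s z≤n) (ring w)))
      (F-even step reflect-β w refl)
    where
    ring : ∀ w → 3 ℕ.* (4 ℕ.+ (w ℕ.+ w) ℕ.* 3)
           ≡ (2 ℕ.+ ((4 ℕ.+ (w ℕ.+ w) ℕ.* 3) ℕ.+ w ℕ.* 3)) ℕ.* 2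
    ring = ℕ-Solver.solve-∀
  -- The range ends with a single index of class `β` after `w` full blocks.
  ... | inj₂ (w , refl) = trans (cong F (range-length n (1 ℕ.+ w ℕ.* 3) 1 (s≤s (s≤s z≤n)) (ring w)))
      (trans (keep 0 w (3∤₀ w)) (F-odd step reflect-β w refl))
    where
    ring : ∀ w → 3 ℕ.* (4 ℕ.+ suc (w ℕ.+ w) ℕ.* 3)
           ≡ 1 ℕ.+ (2 ℕ.+ ((4 ℕ.+ suc (w ℕ.+ w) ℕ.* 3) ℕ.+ (1 ℕ.+ w ℕ.* 3))) ℕ.* 2
    ring = ℕ-Solver.solve-∀

residue₂ : ∀ M → lhs (5 ℕ.+ M ℕ.* 3) ≡ rhs (5 ℕ.+ M ℕ.* 3)
residue₂ M = lhs≡rhs-from-products n M α (quotient 2 (suc M) 3 (s≤s (s≤s (s≤s z≤n)))) (c≢0 2 M)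
  (numer-lhs₂ M (+ n) (n-eq 2 M) (λ ()) (λ ()) (c≢0 2 M)) num (den₂ n M)
  where
  n = 5 ℕ.+ M ℕ.* 3
  α = cShift (+ n) (+ 0)
  β = cShift (+ n) (+ 1)
  open NonMultiples n
  open Residue₊ 2 M β using (F-even; F-odd)

  3∤₁ : ∀ v → ¬ 3 ∣ suc n ℕ.+ (1 ℕ.+ v ℕ.* 3)
  3∤₁ v = subst (λ j → ¬ 3 ∣ j) (sym (index 2 M 1 v)) (3∤1+k*3 (2 ℕ.+ (M ℕ.+ v)))

  3∤₂ : ∀ v → ¬ 3 ∣ suc n ℕ.+ (2 ℕ.+ v ℕ.* 3)
  3∤₂ v = subst (λ j → ¬ 3 ∣ j) (sym (index 2 M 2 v)) (3∤2+k*3 (2 ℕ.+ (M ℕ.+ v)))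

  keep₁ : ∀ v → F (2 ℕ.+ v ℕ.* 3) ≡ F (v ℕ.* 3) ℚ.* ι (β (suc v))
  keep₁ v = trans (keep 1 v (3∤₁ v)) (cong (ℚ._* ι (β (suc v)))
    (skip (v ℕ.* 3) (2 ℕ.+ (M ℕ.+ v)) (index 2 M 0 v)))

  step : ∀ v → F (suc v ℕ.* 3) ≡ F (v ℕ.* 3) ℚ.* ι (β (suc v)) ℚ.* ι (α (suc v))
  step v = trans (keep 2 v (3∤₂ v)) (cong (ℚ._* ι (α (suc v))) (keep₁ v))

  reflect-β : ∀ x y → x ℕ.+ y ≡ M → β (suc y) ≡ α x
  reflect-β x y = cShift-reflect 2 M x y (+ 1) (+ 0) refl

  num : F ((3 ℕ.* n) ℕ./ 2 ∸ 2 ∸ n) ≡ ι (prod α M)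
  num with parity M
  ... | inj₁ (w , refl) = trans (cong F (range-length n (w ℕ.* 3) 1 (s≤s (s≤s z≤n)) (ring w)))
      (F-even step reflect-β w refl)
    where
    ring : ∀ w → 3 ℕ.* (5 ℕ.+ (w ℕ.+ w) ℕ.* 3)
           ≡ 1 ℕ.+ (2 ℕ.+ ((5 ℕ.+ (w ℕ.+ w) ℕ.* 3) ℕ.+ w ℕ.* 3)) ℕ.* 2
    ring = ℕ-Solver.solve-∀
  -- After `w` full blocks come a multiple of 3 and then one index of class `β`.
  ... | inj₂ (w , refl) = trans (cong F (range-length n (2 ℕ.+ w ℕ.* 3) 0 (s≤s z≤n) (ring w)))
      (trans (keep₁ w) (F-odd step reflect-β w refl))
    where
    ring : ∀ w → 3 ℕ.* (5 ℕ.+ suc (w ℕ.+ w) ℕ.* 3)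
           ≡ (2 ℕ.+ ((5 ℕ.+ suc (w ℕ.+ w) ℕ.* 3) ℕ.+ (2 ℕ.+ w ℕ.* 3))) ℕ.* 2
    ring = ℕ-Solver.solve-∀

by-residue : ∀ r q → r ℕ.< 3 → 3 ≤ r ℕ.+ q ℕ.* 3 →
             lhs (r ℕ.+ q ℕ.* 3) ≡ rhs (r ℕ.+ q ℕ.* 3)
by-residue r zero r<3 3≤ = contradiction (subst (3 ≤_) (ℕ.+-identityʳ r) 3≤) (ℕ.<⇒≱ r<3)
by-residue 0 (suc M) _ _ = residue₀ M
by-residue 1 (suc M) _ _ = residue₁ M
by-residue 2 (suc M) _ _ = residue₂ M
by-residue (suc (suc (suc _))) (suc M) (s≤s (s≤s (s≤s ()))) _

theorem1 : (n : ℕ) → 3 ≤ n → lhs n ≡ rhs n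
theorem1 n 3≤n = subst (λ k → lhs k ≡ rhs k) (sym n≡)
  (by-residue (n ℕ.% 3) (n ℕ./ 3) (m%n<n n 3) (subst (3 ≤_) n≡ 3≤n))
  where n≡ = m≡m%n+[m/n]*n n 3
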